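{- Let $\epsilon>0$ and let $G_H$ be (the adjacency matrix of) a Hamiltonian simple directed graph on $n$ vertices. Consider $\max\langle G_H,Q\rangle$ over the finite set of $n!$ points $Q\in Q_t\cup Q_{nt}$. Then $\max\langle G_H,Q\rangle$ is $$\begin{cases} = n(1+\epsilon), & \text{attained for a } Q\in Q_t,\\ \le n(1+\epsilon)-\epsilon, & \text{may be attained for a } Q\in Q_{nt}.\end{cases}$$ Here the first line refers to the maximum over $Q\in Q_t$ and the second line to the maximum over $Q\in Q_{nt}$.
   Context: A simple directed graph on vertices $1,\dots,n$ has no loops and no multiple arcs; it is identified with its $n\times n$ $0/1$ adjacency matrix, which has zero diagonal. It is Hamiltonian if it contains a directed cycle through all $n$ vertices (a tour). For real $n\times n$ matrices, $\langle A,B\rangle=\sum_{i,j}A[i,j]B[i,j]$. $P$ is the set of all $n!$ permutation matrices of size $n\times n$. $P_t\subset P$ is the set of the $(n-1)!$ irreflexive (zero diagonal) permutation matrices which, viewed as adjacency matrices, are directed Hamilton cycles ("tours"), and $P_{nt}=P\setminus P_t$ ("non-tours"). Let $\overline{B_n}$ be the $n\times n$ matrix with all entries equal to $1/n$. Define $$Q_t=\{(1+\epsilon)X : X\in P_t\},\qquad Q_{nt}=\{X+\epsilon\,\overline{B_n} : X\in P_{nt}\}.$$ -}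

module Defs where

open import Algebra.Apartness.Bundles using (HeytingField)
open import Algebra.Bundles using (CommutativeRing)
open import Data.Bool.Base using (Bool; true; false; if_then_else_)
open import Data.Fin.Base using (Fin; toℕ)
open import Data.Fin.Permutation using (Permutation′; _⟨$⟩ʳ_)
open import Data.Nat.Base using (ℕ; zero; suc; NonZero)
open import Data.Nat.DivMod using (_mod_)
open import Data.Product using (_×_; proj₁; ∃; ∃-syntax; ∃!)
open import Data.Sum.Base using (_⊎_; inj₁; inj₂)
open import Function.Bundles using (_⇔_; Equivalence)
open import Level as Level using (_⊔_)
open import Relation.Binary.Core using (Rel)
open import Relation.Binary.PropositionalEquality.Core using (_≡_)
open import Relation.Binary.Structures using (IsStrictPartialOrder)
open import Relation.Nullary.Negation using (¬_)
open import Relation.Unary using (Pred; _∈_)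

-- The standard library has no real numbers, so scalars range over an
-- arbitrary ordered field.  The axioms are the constructive ones: with
-- _#_ read as ≉ this is classically the usual notion of (totally)
-- ordered field, and the classical as well as the constructive reals
-- are instances.
record OrderedField c ℓ₁ ℓ₂ ℓ₃ : Set (Level.suc (c ⊔ ℓ₁ ⊔ ℓ₂ ⊔ ℓ₃)) where
  infix 4 _<_ _≤_
  field
    heytingField : HeytingField c ℓ₁ ℓ₂

  open HeytingField heytingField public

  field
    _<_                    : Rel Carrier ℓ₃
    <-isStrictPartialOrder : IsStrictPartialOrder _≈_ _<_
    #⇔<⊎>                  : ∀ {x y} → x # y ⇔ (x < y ⊎ y < x)
    +-monoˡ-<              : ∀ z {x y} → x < y → x + z < y + z
    *-pos                  : ∀ {x y} → 0# < x → 0# < y → 0# < x * y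

  _≤_ : Rel Carrier ℓ₃
  x ≤ y = ¬ (y < x)

  commutativeRing : CommutativeRing c ℓ₁
  commutativeRing = record { isCommutativeRing = isCommutativeRing }

Matrix : ∀ {a} → Set a → ℕ → Set a
Matrix A n = Fin n → Fin n → A

-- 0/1 matrices are Boolean matrices, with true for the entry 1.
ZeroDiagonal : ∀ {n} → Matrix Bool n → Set
ZeroDiagonal M = ∀ i → M i i ≡ false

record SimpleDigraph (n : ℕ) : Set where
  field
    adjacency    : Matrix Bool n
    zeroDiagonal : ZeroDiagonal adjacency

next : ∀ {n} → Fin n → Fin n
next {suc n} i = suc (toℕ i) mod suc n

-- The permutation v lists the vertices in the order in which the cycle
-- visits them: v 0 → v 1 → ⋯ → v (n-1) → v 0.
Hamiltonian : ∀ {n} → SimpleDigraph n → Set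
Hamiltonian {n} G = ∃ λ (v : Permutation′ n) → ∀ k → adjacency (v ⟨$⟩ʳ k) (v ⟨$⟩ʳ next k) ≡ true
  where
  open SimpleDigraph G

-- The digraph with adjacency matrix M has the arcs of such a cycle and
-- no others.
IsHamiltonCycle : ∀ {n} → Matrix Bool n → Set
IsHamiltonCycle {n} M = ∃ λ (v : Permutation′ n) → ∀ i j →
  M i j ≡ true ⇔ (∃[ k ] i ≡ v ⟨$⟩ʳ k × j ≡ v ⟨$⟩ʳ next k)

P : ∀ {n} → Pred (Matrix Bool n) _
P M = (∀ i → ∃! _≡_ λ j → M i j ≡ true) × (∀ j → ∃! _≡_ λ i → M i j ≡ true)

Pₜ : ∀ {n} → Pred (Matrix Bool n) _
Pₜ M = M ∈ P × ZeroDiagonal M × IsHamiltonCycle M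

Pₙₜ : ∀ {n} → Pred (Matrix Bool n) _
Pₙₜ M = M ∈ P × ¬ (M ∈ Pₜ)

module Over {c ℓ₁ ℓ₂ ℓ₃} (F : OrderedField c ℓ₁ ℓ₂ ℓ₃) where

  open OrderedField F
  open CommutativeRing commutativeRing using (ring; +-commutativeMonoid; +-monoid)
  open import Algebra.Apartness.Properties.HeytingCommutativeRing
    (HeytingField.heytingCommutativeRing heytingField) using (1#0)
  open import Algebra.Properties.CommutativeMonoid.Sum +-commutativeMonoid
    using (sum-syntax)
  open import Algebra.Properties.Monoid.Mult +-monoid
    using () renaming (_×_ to _·_)
  open import Algebra.Properties.Ring ring using (-‿distribˡ-*; -‿involutive)
  open IsStrictPartialOrder <-isStrictPartialOrder
    using (<-respˡ-≈; <-respʳ-≈) renaming (trans to <-trans)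

  ι : ℕ → Carrier
  ι n = n · 1#

  0<1 : 0# < 1#
  0<1 with Equivalence.to #⇔<⊎> 1#0
  ... | inj₂ 0<1 = 0<1
  ... | inj₁ 1<0 = <-respʳ-≈ -1*-1≈1 (*-pos 0<-1 0<-1)
    where
    0<-1 : 0# < - 1#
    0<-1 = <-respˡ-≈ (-‿inverseʳ 1#)
             (<-respʳ-≈ (+-identityˡ (- 1#)) (+-monoˡ-< (- 1#) 1<0))
    -1*-1≈1 : - 1# * - 1# ≈ 1#
    -1*-1≈1 = trans (sym (-‿distribˡ-* 1# (- 1#)))
                (trans (-‿cong (*-identityˡ (- 1#))) (-‿involutive 1#))

  0<ι : ∀ n → .{{NonZero n}} → 0# < ι n
  0<ι (suc zero)      = <-respʳ-≈ (sym (+-identityʳ 1#)) 0<1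
  0<ι (suc n@(suc _)) = <-trans (0<ι n)
    (<-respˡ-≈ (+-identityˡ (ι n)) (+-monoˡ-< (ι n) 0<1))

  1/ : ∀ n → .{{NonZero n}} → Carrier
  1/ n = proj₁ (#⇒invertible (Equivalence.from #⇔<⊎> (inj₂ (0<ι n))))

  ⟦_⟧ : ∀ {n} → Matrix Bool n → Matrix Carrier n
  ⟦ M ⟧ i j = if M i j then 1# else 0#

  ⟨_,_⟩ : ∀ {n} → Matrix Carrier n → Matrix Carrier n → Carrier
  ⟨_,_⟩ {n} A B = ∑[ i < n ] (∑[ j < n ] (A i j * B i j))

  B̄ : ∀ n → .{{NonZero n}} → Matrix Carrier n
  B̄ n i j = 1/ n

  Qₜ : ∀ {n} → Carrier → Pred (Matrix Carrier n) _
  Qₜ ε Q = ∃[ X ] X ∈ Pₜ × (∀ i j → Q i j ≈ (1# + ε) * ⟦ X ⟧ i j)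

  Qₙₜ : ∀ {n} → .{{NonZero n}} → Carrier → Pred (Matrix Carrier n) _
  Qₙₜ {n} ε Q = ∃[ X ] X ∈ Pₙₜ × (∀ i j → Q i j ≈ ⟦ X ⟧ i j + ε * B̄ n i j)

  -- m = max { f x : x ∈ S }; in particular the maximum is attained.
  IsMaximum : ∀ {a s} {A : Set a} → (A → Carrier) → Pred A s → Carrier → Set _
  IsMaximum f S m = (∃[ x ] x ∈ S × f x ≈ m) × (∀ x → x ∈ S → f x ≤ m)

{-# OPTIONS --safe #-}
module Submission where

-- On 0/1 matrices both objectives are counts of common arcs: with
-- k = |G ∩ X| and e the number of arcs of G, the value at X is (1 + ε) k
-- for a tour and k + (ε/n) e for a non-tour.  Each row of a permutation
-- matrix meets G at most once, so k ≤ n, with equality for the tour inside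
-- G; and e ≤ n (n - 1) because G has no loops.  A best non-tour is found
-- constructively by exhausting the functions Fin n → Fin n, which works
-- because being a tour is decidable.

open import Defs
open import Data.Nat.Base using (ℕ; NonZero)
open import Data.Product using (_×_; Σ-syntax; ∃-syntax)
open import Relation.Unary using (_∈_)

open import Algebra.Bundles using (CommutativeRing)
import Algebra.Properties.CommutativeMonoid.Sum as CommutativeMonoidSum
import Algebra.Properties.Ring as RingProperties
import Algebra.Properties.Semiring.Mult as SemiringMult
import Algebra.Properties.Semiring.Sum as SemiringSum
open import Data.Bool.Base using (Bool; true; false; not; _∧_; if_then_else_)
import Data.Bool.Properties as Bool
open import Data.Empty using (⊥-elim)
open import Data.Fin.Base using (Fin; zero; suc; toℕ; fromℕ; inject₁; punchIn; opposite; finToFun; funToFin)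
open import Data.Fin.Patterns using (0F; 1F; 2F; 3F)
open import Data.Fin.Permutation as Perm using (Permutation′; permutation; _⟨$⟩ʳ_; _⟨$⟩ˡ_; flip; _∘ₚ_)
open import Data.Fin.Properties
  using (_≟_; any?; all?; toℕ-injective; toℕ-fromℕ; toℕ-fromℕ<; toℕ-inject₁; toℕ<n; punchInᵢ≢i; opposite-involutive; finToFun-funToFin)
open import Data.Fin.Relation.Unary.Top using (view; ‵fromℕ; ‵inject₁)
open import Data.List.Base using (List; map; filter; allFin)
open import Data.List.Membership.Propositional.Properties using (∈-filter⁺; ∈-map⁺; ∈-allFin)
open import Data.List.Relation.Unary.All using (lookup)
open import Data.List.Relation.Unary.All.Properties using (all-filter)
open import Data.Nat.Base as ℕ using (zero; suc; s≤s; z≤n; s<s)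
open import Data.Nat.DivMod using (_%_; m<n⇒m%n≡m; m%n<n; n%n≡0)
import Data.Nat.Properties as ℕ
open import Data.List.Extrema ℕ.≤-totalOrder using (argmax; argmax-all; f[xs]≤f[argmax])
open import Data.Product using (_,_; proj₁; proj₂; ∃; ∃!; uncurry)
open import Data.Sum.Base using (inj₁; inj₂)
open import Function.Base using (_∘_)
open import Function.Bundles using (_⇔_; mk⇔; Equivalence)
open import Level using (Level)
import Relation.Binary.Construct.StrictToNonStrict as NonStrict
open import Relation.Binary.PropositionalEquality as ≡ using (_≡_; _≢_; _≗_)
import Relation.Binary.Reasoning.Setoid as SetoidReasoning
open import Relation.Binary.Structures using (IsStrictPartialOrder)
open import Relation.Nullary using (Dec; does; yes; no)
open import Relation.Nullary.Decidable using (map′; _×-dec_; _→-dec_; ¬?; dec-true)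
open import Relation.Unary using (Pred; Decidable)

open Equivalence using (to; from)

private
  variable
    a b ℓ : Level
    A B : Set a
    m n : ℕ

-- Decidability of unique existence and of existence over functions between finite sets.

does⁻ : (A? : Dec A) → does A? ≡ true → A
does⁻ (yes x) _ = x

infix 4 _⇔-dec_

_⇔-dec_ : Dec A → Dec B → Dec (A ⇔ B)
A? ⇔-dec B? = map′ (uncurry mk⇔) (λ e → to e , from e) ((A? →-dec B?) ×-dec (B? →-dec A?))

-- Uniqueness is contravariant in the predicate, so both implications are required.
∃!-map : {P : Pred A a} {Q : Pred A b} → (∀ {x} → P x → Q x) → (∀ {x} → Q x → P x) → ∃! _≡_ P → ∃! _≡_ Q
∃!-map f g (x , px , unique) = x , f px , unique ∘ g

∃!? : {P : Pred (Fin n) ℓ} → Decidable P → Dec (∃! _≡_ P)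
∃!? P? = map′ (λ (x , px , unique) → x , px , λ {y} → unique y) (λ (x , px , unique) → x , px , λ _ → unique)
  (any? λ x → P? x ×-dec all? (λ y → P? y →-dec (x ≟ y)))

-- Functions are searched through their finitely many codes. Decoding the code of `f` returns `f`
-- only pointwise, hence the hypothesis that `Q` respects `_≗_`.
anyFunction? : {Q : Pred (Fin m → Fin n) ℓ} → (∀ {f g} → f ≗ g → Q f → Q g) → Decidable Q → Dec (∃ Q)
anyFunction? resp Q? = map′
  (λ (k , q) → finToFun k , q)
  (λ (f , q) → funToFin f , resp (≡.sym ∘ finToFun-funToFin f) q)
  (any? (Q? ∘ finToFun))

-- The cyclic successor as a permutation.

prev : Fin (suc n) → Fin (suc n)
prev {n} zero = fromℕ n
prev (suc i)  = inject₁ i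

toℕ-next : (i : Fin (suc n)) → toℕ (next i) ≡ suc (toℕ i) % suc n
toℕ-next {n} i = toℕ-fromℕ< (m%n<n (suc (toℕ i)) (suc n))

next-fromℕ : ∀ n → next (fromℕ n) ≡ zero
next-fromℕ n = toℕ-injective (begin
  toℕ (next (fromℕ n))           ≡⟨ toℕ-next (fromℕ n) ⟩
  suc (toℕ (fromℕ n)) % suc n    ≡⟨ ≡.cong (λ k → suc k % suc n) (toℕ-fromℕ n) ⟩
  suc n % suc n                  ≡⟨ n%n≡0 (suc n) ⟩
  0                              ∎)
  where open ≡.≡-Reasoning

next-inject₁ : (i : Fin n) → next (inject₁ i) ≡ suc i
next-inject₁ {n} i = toℕ-injective (begin
  toℕ (next (inject₁ i))           ≡⟨ toℕ-next (inject₁ i) ⟩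
  suc (toℕ (inject₁ i)) % suc n    ≡⟨ ≡.cong (λ k → suc k % suc n) (toℕ-inject₁ i) ⟩
  suc (toℕ i) % suc n              ≡⟨ m<n⇒m%n≡m (s<s (toℕ<n i)) ⟩
  suc (toℕ i)                      ∎)
  where open ≡.≡-Reasoning

next-prev : (i : Fin (suc n)) → next (prev i) ≡ i
next-prev {n} zero = next-fromℕ n
next-prev (suc i)  = next-inject₁ i

prev-next : (i : Fin (suc n)) → prev (next i) ≡ i
prev-next {n} i with view i
... | ‵fromℕ     = ≡.cong prev (next-fromℕ n)
... | ‵inject₁ j = ≡.cong prev (next-inject₁ j)

nextₚ : Permutation′ (suc n)
nextₚ = permutation next prev next-prev prev-next

-- Pointwise equality of matrices, and decidability of being a tour.

infix 4 _≋_

_≋_ : Matrix Bool n → Matrix Bool n → Set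
M ≋ N = ∀ i j → M i j ≡ N i j

≋-sym : {M N : Matrix Bool n} → M ≋ N → N ≋ M
≋-sym M≋N i j = ≡.sym (M≋N i j)

P-resp-≋ : {M N : Matrix Bool n} → M ≋ N → M ∈ P → N ∈ P
P-resp-≋ M≋N (rows , columns) =
  (λ i → ∃!-map (≡.trans (≡.sym (M≋N i _))) (≡.trans (M≋N i _)) (rows i)) ,
  (λ j → ∃!-map (≡.trans (≡.sym (M≋N _ j))) (≡.trans (M≋N _ j)) (columns j))

Pₜ-resp-≋ : {M N : Matrix Bool n} → M ≋ N → M ∈ Pₜ → N ∈ Pₜ
Pₜ-resp-≋ M≋N (M∈P , diag , v , cycle) =
  P-resp-≋ M≋N M∈P ,
  (λ i → ≡.trans (≡.sym (M≋N i i)) (diag i)) ,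
  v , λ i j → mk⇔ (to (cycle i j) ∘ ≡.trans (M≋N i j)) (≡.trans (≡.sym (M≋N i j)) ∘ from (cycle i j))

Pₙₜ-resp-≋ : {M N : Matrix Bool n} → M ≋ N → M ∈ Pₙₜ → N ∈ Pₙₜ
Pₙₜ-resp-≋ M≋N (M∈P , M∉Pₜ) = P-resp-≋ M≋N M∈P , M∉Pₜ ∘ Pₜ-resp-≋ (≋-sym M≋N)

P? : Decidable (P {n})
P? M = all? (λ i → ∃!? λ j → M i j Bool.≟ true) ×-dec all? (λ j → ∃!? λ i → M i j Bool.≟ true)

-- A permutation is a function with a two-sided inverse, so two nested searches over plain
-- functions, first for `f` and then for its inverse, cover all vertex orders.
IsHamiltonCycle? : Decidable (IsHamiltonCycle {n})
IsHamiltonCycle? {n} M = map′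
  (λ (f , (g , fg , gf) , cycle) → permutation f g fg gf , cycle)
  (λ (v , cycle) → (v ⟨$⟩ʳ_) , ((v ⟨$⟩ˡ_) , (λ _ → Perm.inverseʳ v) , (λ _ → Perm.inverseˡ v)) , cycle)
  (anyFunction? resp λ f → inverse? f ×-dec cycle? f)
  where
  Inverses : (f g : Fin n → Fin n) → Set
  Inverses f g = (∀ k → f (g k) ≡ k) × (∀ k → g (f k) ≡ k)

  Cycle : (Fin n → Fin n) → Set
  Cycle f = ∀ i j → M i j ≡ true ⇔ (∃[ k ] i ≡ f k × j ≡ f (next k))

  inverse? : ∀ f → Dec (∃ (Inverses f))
  inverse? f = anyFunction?
    (λ g≗h (fg , gf) → (λ k → ≡.trans (≡.cong f (≡.sym (g≗h k))) (fg k)) , (λ k → ≡.trans (≡.sym (g≗h (f k))) (gf k)))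
    (λ g → all? (λ k → f (g k) ≟ k) ×-dec all? (λ k → g (f k) ≟ k))

  cycle? : Decidable Cycle
  cycle? f = all? λ i → all? λ j → (M i j Bool.≟ true) ⇔-dec any? (λ k → (i ≟ f k) ×-dec (j ≟ f (next k)))

  resp : ∀ {f g} → f ≗ g → ∃ (Inverses f) × Cycle f → ∃ (Inverses g) × Cycle g
  resp f≗g ((h , fh , hf) , cycle) =
    (h , (λ k → ≡.trans (≡.sym (f≗g (h k))) (fh k)) , (λ k → ≡.trans (≡.cong h (≡.sym (f≗g k))) (hf k))) ,
    λ i j → mk⇔
      (λ Mij → let (k , i≡ , j≡) = to (cycle i j) Mij in k , ≡.trans i≡ (f≗g k) , ≡.trans j≡ (f≗g (next k)))
      (λ (k , i≡ , j≡) → from (cycle i j) (k , ≡.trans i≡ (≡.sym (f≗g k)) , ≡.trans j≡ (≡.sym (f≗g (next k)))))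

Pₜ? : Decidable (Pₜ {n})
Pₜ? M = P? M ×-dec all? (λ i → M i i Bool.≟ false) ×-dec IsHamiltonCycle? M

Pₙₜ? : Decidable (Pₙₜ {n})
Pₙₜ? M = P? M ×-dec ¬? (Pₜ? M)

-- Permutation matrices as graphs of functions.

graph : (Fin n → Fin n) → Matrix Bool n
graph σ i j = does (σ i ≟ j)

graph⁺ : (σ : Fin n → Fin n) {i j : Fin n} → σ i ≡ j → graph σ i j ≡ true
graph⁺ σ {i} {j} = dec-true (σ i ≟ j)

graph⁻ : (σ : Fin n → Fin n) {i j : Fin n} → graph σ i j ≡ true → σ i ≡ j
graph⁻ σ {i} {j} = does⁻ (σ i ≟ j)

graph∈P : (π : Permutation′ n) → graph (π ⟨$⟩ʳ_) ∈ P
graph∈P π =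
  (λ i → π ⟨$⟩ʳ i , graph⁺ (π ⟨$⟩ʳ_) ≡.refl , graph⁻ (π ⟨$⟩ʳ_)) ,
  (λ j → π ⟨$⟩ˡ j , graph⁺ (π ⟨$⟩ʳ_) (Perm.inverseʳ π) ,
    λ {i} πij → ≡.trans (≡.cong (π ⟨$⟩ˡ_) (≡.sym (graph⁻ (π ⟨$⟩ʳ_) πij))) (Perm.inverseˡ π))

row : {M : Matrix Bool n} → M ∈ P → Fin n → Fin n
row (rows , _) i = proj₁ (rows i)

row-true : {M : Matrix Bool n} (p : M ∈ P) → ∀ i → M i (row p i) ≡ true
row-true (rows , _) i = proj₁ (proj₂ (rows i))

row-unique : {M : Matrix Bool n} (p : M ∈ P) → ∀ {i j} → M i j ≡ true → row p i ≡ j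
row-unique (rows , _) {i} = proj₂ (proj₂ (rows i))

-- A permutation matrix is determined by the column of the 1 in each row. Allowing any `σ` pointwise
-- equal to `row p` makes this applicable to decoded functions.
graph-row : {M : Matrix Bool n} (p : M ∈ P) {σ : Fin n → Fin n} → σ ≗ row p → M ≋ graph σ
graph-row {M = M} p {σ} σ≗row i j with σ i ≟ j
... | yes ≡.refl = ≡.trans (≡.cong (M i) (σ≗row i)) (row-true p i)
... | no  σi≢j   = Bool.¬-not (σi≢j ∘ ≡.trans (σ≗row i) ∘ row-unique p)

-- A loop rules out a tour. This shows that there are non-tours in every positive dimension.
identity∈Pₙₜ : graph {suc n} (λ i → i) ∈ Pₙₜ
identity∈Pₙₜ = graph∈P Perm.id , λ (_ , diag , _) → Bool.not-¬ (diag zero) ≡.refl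

-- Counting common arcs.

module ℕΣ = CommutativeMonoidSum ℕ.+-0-commutativeMonoid

bit : Bool → ℕ
bit b = if b then 1 else 0

bit≤1 : ∀ b → bit b ℕ.≤ 1
bit≤1 true  = s≤s z≤n
bit≤1 false = z≤n

count : (Fin n → Bool) → ℕ
count f = ℕΣ.sum (bit ∘ f)

-- The inner product of two 0/1 matrices, kept in `ℕ` because a best non-tour is selected by
-- comparing values and the order there is decidable.
commonArcs : Matrix Bool n → Matrix Bool n → ℕ
commonArcs M N = ℕΣ.sum λ i → count λ j → M i j ∧ N i j

-- The all-ones matrix: `commonArcs M full` is the number of arcs of `M`.
full : Matrix Bool n
full i j = true

commonArcs-congʳ : (M : Matrix Bool n) {N N′ : Matrix Bool n} → N ≋ N′ → commonArcs M N ≡ commonArcs M N′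
commonArcs-congʳ M N≋N′ = ℕΣ.sum-cong-≗ λ i → ℕΣ.sum-cong-≗ λ j → ≡.cong (λ b → bit (M i j ∧ b)) (N≋N′ i j)

sum-≤ : ∀ {c} (f : Fin n → ℕ) → (∀ i → f i ℕ.≤ c) → ℕΣ.sum f ℕ.≤ n ℕ.* c
sum-≤ {zero}  f f≤c = z≤n
sum-≤ {suc n} f f≤c = ℕ.+-mono-≤ (f≤c zero) (sum-≤ (f ∘ suc) (f≤c ∘ suc))

sum-const : ∀ {c} (f : Fin n → ℕ) → (∀ i → f i ≡ c) → ℕΣ.sum f ≡ n ℕ.* c
sum-const {zero}  f f≡c = ≡.refl
sum-const {suc n} f f≡c = ≡.cong₂ ℕ._+_ (f≡c zero) (sum-const (f ∘ suc) (f≡c ∘ suc))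

count-≤ : (f : Fin n → Bool) → count f ℕ.≤ n
count-≤ {n} f = ℕ.≤-trans (sum-≤ (bit ∘ f) (bit≤1 ∘ f)) (ℕ.≤-reflexive (ℕ.*-identityʳ n))

-- Once position `k` is split off, every remaining term is 0. Whether `f` holds at `k` itself is
-- left open.
count-unique : (f : Fin n → Bool) (k : Fin n) → (∀ {j} → f j ≡ true → k ≡ j) → count f ≡ bit (f k)
count-unique {suc n} f k unique = begin
  count f                                    ≡⟨ ℕΣ.sum-remove {i = k} (bit ∘ f) ⟩
  bit (f k) ℕ.+ count (f ∘ punchIn k)        ≡⟨ ≡.cong (bit (f k) ℕ.+_) (sum-const _ rest) ⟩
  bit (f k) ℕ.+ n ℕ.* 0                      ≡⟨ ≡.cong (bit (f k) ℕ.+_) (ℕ.*-zeroʳ n) ⟩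
  bit (f k) ℕ.+ 0                            ≡⟨ ℕ.+-identityʳ _ ⟩
  bit (f k)                                  ∎
  where
  open ≡.≡-Reasoning
  rest : ∀ j → bit (f (punchIn k j)) ≡ 0
  rest j = ≡.cong bit (Bool.¬-not (punchInᵢ≢i k j ∘ ≡.sym ∘ unique))

count-commonArcs-row : (M : Matrix Bool n) {X : Matrix Bool n} (p : X ∈ P) → ∀ i →
                    count (λ j → M i j ∧ X i j) ≡ bit (M i (row p i))
count-commonArcs-row M {X} p i = begin
  count (λ j → M i j ∧ X i j)             ≡⟨ count-unique _ (row p i) (row-unique p ∘ ∧-true₂ (M i _)) ⟩
  bit (M i (row p i) ∧ X i (row p i))     ≡⟨ ≡.cong (λ b → bit (M i (row p i) ∧ b)) (row-true p i) ⟩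
  bit (M i (row p i) ∧ true)              ≡⟨ ≡.cong bit (Bool.∧-identityʳ _) ⟩
  bit (M i (row p i))                     ∎
  where
  open ≡.≡-Reasoning
  ∧-true₂ : ∀ x {y} → x ∧ y ≡ true → y ≡ true
  ∧-true₂ true eq = eq

commonArcs-P : (M : Matrix Bool n) {X : Matrix Bool n} → X ∈ P → commonArcs M X ℕ.≤ n
commonArcs-P {n} M {X} p = ℕ.≤-trans
  (sum-≤ _ (λ i → ℕ.≤-trans (ℕ.≤-reflexive (count-commonArcs-row M p i)) (bit≤1 _)))
  (ℕ.≤-reflexive (ℕ.*-identityʳ n))

commonArcs-subgraph : (M : Matrix Bool n) {X : Matrix Bool n} (p : X ∈ P) → (∀ i → M i (row p i) ≡ true) → commonArcs M X ≡ n
commonArcs-subgraph {n} M p sub = ≡.trans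
  (sum-const _ (λ i → ≡.trans (count-commonArcs-row M p i) (≡.cong bit (sub i))))
  (ℕ.*-identityʳ n)

-- Each row loses its diagonal entry, which leaves at most `n` arcs in each of the `suc n` rows.
commonArcs-full : {M : Matrix Bool (suc n)} → ZeroDiagonal M → commonArcs M full ℕ.≤ suc n ℕ.* n
commonArcs-full {n} {M} diag = sum-≤ _ λ i → begin
  count (λ j → M i j ∧ true)                                          ≡⟨ ℕΣ.sum-remove {i = i} (λ j → bit (M i j ∧ true)) ⟩
  bit (M i i ∧ true) ℕ.+ count (λ j → M i (punchIn i j) ∧ true)       ≡⟨ ≡.cong (λ b → bit (b ∧ true) ℕ.+ count (λ j → M i (punchIn i j) ∧ true)) (diag i) ⟩
  count (λ j → M i (punchIn i j) ∧ true)                              ≤⟨ count-≤ (λ j → M i (punchIn i j) ∧ true) ⟩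
  n                                                                   ∎
  where open ℕ.≤-Reasoning

-- A best non-tour by exhaustive search.

maximalNonTour : (M : Matrix Bool (suc n)) →
                 ∃[ X ] X ∈ Pₙₜ × (∀ {Y} → Y ∈ Pₙₜ → commonArcs M Y ℕ.≤ commonArcs M X)
-- The identity matrix is the default value of `argmax`; being a non-tour itself, it keeps the
-- result in `Pₙₜ`.
maximalNonTour {n} M = argmax (commonArcs M) (graph λ i → i) candidates ,
  argmax-all (commonArcs M) identity∈Pₙₜ (all-filter Pₙₜ? (map decode (allFin _))) ,
  maximal
  where
  decode : Fin (suc n ℕ.^ suc n) → Matrix Bool (suc n)
  decode = graph ∘ finToFun

  candidates : List (Matrix Bool (suc n))
  candidates = filter Pₙₜ? (map decode (allFin _))

  maximal : ∀ {Y} → Y ∈ Pₙₜ → commonArcs M Y ℕ.≤ commonArcs M (argmax (commonArcs M) (graph λ i → i) candidates)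
  -- `Y` is only pointwise equal to a listed candidate, so its count and its membership are both
  -- transported along `Y≋`.
  maximal {Y} Y∈Pₙₜ@(Y∈P , _) = ℕ.≤-trans (ℕ.≤-reflexive (commonArcs-congʳ M Y≋))
    (lookup (f[xs]≤f[argmax] {f = commonArcs M} _ candidates)
      (∈-filter⁺ Pₙₜ? (∈-map⁺ decode (∈-allFin code)) (Pₙₜ-resp-≋ Y≋ Y∈Pₙₜ)))
    where
    code = funToFin (row Y∈P)
    Y≋ : Y ≋ decode code
    Y≋ = graph-row Y∈P (finToFun-funToFin (row Y∈P))

-- The tour contained in a Hamiltonian digraph.

module _ (G : SimpleDigraph (suc n)) (hamiltonian : Hamiltonian G) where
  open SimpleDigraph G

  private
    v = proj₁ hamiltonian

  -- Composition runs from left to right: vertex to position, to the next position, and back to a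
  -- vertex.
  successor : Permutation′ (suc n)
  successor = flip v ∘ₚ nextₚ ∘ₚ v

  tour : Matrix Bool (suc n)
  tour = graph (successor ⟨$⟩ʳ_)

  tour⊆G : ∀ i → adjacency i (successor ⟨$⟩ʳ i) ≡ true
  tour⊆G i = ≡.subst (λ w → adjacency w (successor ⟨$⟩ʳ i) ≡ true) (Perm.inverseʳ v) (proj₂ hamiltonian (v ⟨$⟩ˡ i))

  tour∈Pₜ : tour ∈ Pₜ
  tour∈Pₜ = graph∈P successor , diag , v , λ i j → mk⇔ (to′ i j) (from′ i j)
    where
    diag : ZeroDiagonal tour
    -- A loop of the tour would be a loop of `G`.
    diag i = Bool.¬-not λ loop → Bool.not-¬
      (≡.trans (≡.cong (adjacency i) (≡.sym (graph⁻ (successor ⟨$⟩ʳ_) loop))) (tour⊆G i))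
      (zeroDiagonal i)

    to′ : ∀ i j → tour i j ≡ true → ∃[ k ] i ≡ v ⟨$⟩ʳ k × j ≡ v ⟨$⟩ʳ next k
    to′ i j arc = v ⟨$⟩ˡ i , ≡.sym (Perm.inverseʳ v) , ≡.sym (graph⁻ (successor ⟨$⟩ʳ_) arc)

    from′ : ∀ i j → ∃[ k ] i ≡ v ⟨$⟩ʳ k × j ≡ v ⟨$⟩ʳ next k → tour i j ≡ true
    from′ _ _ (k , ≡.refl , ≡.refl) =
      graph⁺ (successor ⟨$⟩ʳ_) (≡.cong (λ l → v ⟨$⟩ʳ next l) (Perm.inverseˡ v))

  commonArcs-tour : commonArcs adjacency tour ≡ suc n
  commonArcs-tour = commonArcs-subgraph adjacency (graph∈P successor) tour⊆G

-- Equality in the bound for non-tours needs a complete digraph with a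
-- fixed-point-free non-tour; n = 4, with two disjoint 2-cycles, is the
-- smallest case.
K₄ : SimpleDigraph 4
K₄ = record
  { adjacency    = λ i j → not (does (i ≟ j))
  ; zeroDiagonal = λ i → ≡.cong not (dec-true (i ≟ i) ≡.refl)
  }

K₄-hamiltonian : Hamiltonian K₄
K₄-hamiltonian = Perm.id , λ { 0F → ≡.refl ; 1F → ≡.refl ; 2F → ≡.refl ; 3F → ≡.refl }

-- Reversal swaps 0 with 3 and 1 with 2.
twoCycles : Matrix Bool 4
twoCycles = graph (Perm.reverse ⟨$⟩ʳ_)

twoCycles∈Pₙₜ : twoCycles ∈ Pₙₜ
twoCycles∈Pₙₜ = graph∈P Perm.reverse , λ (_ , _ , v , cycle) →
  let arc : ∀ k → opposite (v ⟨$⟩ʳ k) ≡ v ⟨$⟩ʳ next k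
      arc k = graph⁻ opposite {v ⟨$⟩ʳ k} (from (cycle _ _) (k , ≡.refl , ≡.refl))
      -- Reversal is an involution, so two steps along the supposed cycle return to its start,
      -- against injectivity of `v`.
      v2≡v0 : v ⟨$⟩ʳ 2F ≡ v ⟨$⟩ʳ 0F
      v2≡v0 = ≡.trans (≡.sym (arc 1F))
        (≡.trans (≡.cong opposite (≡.sym (arc 0F))) (opposite-involutive (v ⟨$⟩ʳ 0F)))
  in 2≢0 (≡.trans (≡.sym (Perm.inverseˡ v)) (≡.trans (≡.cong (v ⟨$⟩ˡ_) v2≡v0) (Perm.inverseˡ v)))
  where
  2≢0 : _≢_ {A = Fin 4} 2F 0F
  2≢0 ()

-- Ordered field arithmetic.

module _ {c ℓ₁ ℓ₂ ℓ₃} (F : OrderedField c ℓ₁ ℓ₂ ℓ₃) where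
  open OrderedField F hiding (zero)
  open Over F
  open CommutativeRing commutativeRing using (ring; semiring)
  open SemiringMult semiring using (×-homo-+; ×1-homo-*; ×-congˡ)
  open SemiringSum semiring using (sum; *-distribˡ-sum)
  open CommutativeMonoidSum (CommutativeRing.+-commutativeMonoid commutativeRing) using (sum-cong-≋; ∑-distrib-+)
  open RingProperties ring using (-0#≈0#)
  open IsStrictPartialOrder <-isStrictPartialOrder
    using (irrefl; <-respˡ-≈; <-respʳ-≈; <-resp-≈) renaming (trans to <-trans)
  open NonStrict _≈_ _<_ using () renaming (_≤_ to _≲_; trans to ≲-trans′)

  ≲-trans : ∀ {x y z} → x ≲ y → y ≲ z → x ≲ z
  ≲-trans = ≲-trans′ isEquivalence <-resp-≈ <-trans

  -- Estimates are made with `_≲_`, strict or equal, where case analysis is available; they are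
  -- weakened to the negative relation `_≤_` only at the end.
  ≲⇒≤ : ∀ {x y} → x ≲ y → x ≤ y
  ≲⇒≤ (inj₁ x<y) y<x = irrefl refl (<-trans x<y y<x)
  ≲⇒≤ (inj₂ x≈y) y<x = irrefl (sym x≈y) y<x

  +-monoˡ-≲ : ∀ z {x y} → x ≲ y → x + z ≲ y + z
  +-monoˡ-≲ z (inj₁ x<y) = inj₁ (+-monoˡ-< z x<y)
  +-monoˡ-≲ z (inj₂ x≈y) = inj₂ (+-congʳ x≈y)

  +-monoʳ-≲ : ∀ z {x y} → x ≲ y → z + x ≲ z + y
  +-monoʳ-≲ z x≲y = ≲-trans (inj₂ (+-comm _ _)) (≲-trans (+-monoˡ-≲ z x≲y) (inj₂ (+-comm _ _)))

  -- The axiom `*-pos` concerns products of positive elements, so it is applied to `z` and `y - x`,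
  -- and `z * x` is added back.
  *-monoʳ-< : ∀ {z x y} → 0# < z → x < y → z * x < z * y
  *-monoʳ-< {z} {x} {y} 0<z x<y = <-respˡ-≈ (+-identityˡ _) (<-respʳ-≈ shift (+-monoˡ-< (z * x) 0<z[y-x]))
    where
    open SetoidReasoning setoid
    0<z[y-x] : 0# < z * (y - x)
    0<z[y-x] = *-pos 0<z (<-respˡ-≈ (-‿inverseʳ x) (+-monoˡ-< (- x) x<y))
    shift : z * (y - x) + z * x ≈ z * y
    shift = begin
      z * (y - x) + z * x    ≈⟨ distribˡ z (y - x) x ⟨
      z * (y - x + x)        ≈⟨ *-congˡ (+-assoc y (- x) x) ⟩
      z * (y + (- x + x))    ≈⟨ *-congˡ (+-congˡ (-‿inverseˡ x)) ⟩
      z * (y + 0#)           ≈⟨ *-congˡ (+-identityʳ y) ⟩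
      z * y                  ∎

  *-monoʳ-≲ : ∀ {z x y} → 0# < z → x ≲ y → z * x ≲ z * y
  *-monoʳ-≲ 0<z (inj₁ x<y) = inj₁ (*-monoʳ-< 0<z x<y)
  *-monoʳ-≲ 0<z (inj₂ x≈y) = inj₂ (*-congˡ x≈y)

  ι-mono : ∀ {m n} → m ℕ.≤ n → ι m ≲ ι n
  ι-mono {n = zero}  z≤n       = inj₂ refl
  ι-mono {n = suc n} z≤n       = inj₁ (0<ι (suc n))
  ι-mono             (s≤s m≤n) = +-monoʳ-≲ 1# (ι-mono m≤n)

  -- `#⇒invertible` inverts a difference of two apart elements; for `1/` the second element is zero.
  x-0#≈x : ∀ x → x - 0# ≈ x
  x-0#≈x x = trans (+-congˡ -0#≈0#) (+-identityʳ x)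

  ι*1/ : ∀ n .{{_ : NonZero n}} → ι n * 1/ n ≈ 1#
  ι*1/ n = trans (*-congʳ (sym (x-0#≈x (ι n))))
    (proj₂ (proj₂ (#⇒invertible (from #⇔<⊎> (inj₂ (0<ι n))))))

  -- An invertible element is apart from zero, hence positive or negative; a negative reciprocal,
  -- multiplied by `ι n`, would give 1 < 0.
  0<1/ : ∀ n .{{_ : NonZero n}} → 0# < 1/ n
  0<1/ n with to #⇔<⊎> (invertible⇒# (ι n , trans (*-congˡ (x-0#≈x (1/ n))) (ι*1/ n)
                                            , trans (*-congʳ (x-0#≈x (1/ n))) (trans (*-comm _ _) (ι*1/ n))))
  ... | inj₂ 0<1/n = 0<1/n
  ... | inj₁ 1/n<0 = ⊥-elim (irrefl refl (<-trans 0<1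
          (<-respˡ-≈ (ι*1/ n) (<-respʳ-≈ (zeroʳ (ι n)) (*-monoʳ-< (0<ι n) 1/n<0)))))

  -- Double sums and linearity of the inner product.

  ∑∑ : (Fin m → Fin n → Carrier) → Carrier
  ∑∑ f = sum λ i → sum (f i)

  ∑∑-cong : {f g : Fin m → Fin n → Carrier} → (∀ i j → f i j ≈ g i j) → ∑∑ f ≈ ∑∑ g
  ∑∑-cong f≈g = sum-cong-≋ λ i → sum-cong-≋ (f≈g i)

  ∑∑-distrib-+ : (f g : Fin m → Fin n → Carrier) → ∑∑ (λ i j → f i j + g i j) ≈ ∑∑ f + ∑∑ g
  ∑∑-distrib-+ f g = trans (sum-cong-≋ λ i → ∑-distrib-+ (f i) (g i)) (∑-distrib-+ (sum ∘ f) (sum ∘ g))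

  *-distribˡ-∑∑ : ∀ x (f : Fin m → Fin n → Carrier) → x * ∑∑ f ≈ ∑∑ (λ i j → x * f i j)
  *-distribˡ-∑∑ x f = trans (*-distribˡ-sum x (sum ∘ f)) (sum-cong-≋ λ i → *-distribˡ-sum x (f i))

  ι-sum : (f : Fin n → ℕ) → ι (ℕΣ.sum f) ≈ sum (ι ∘ f)
  ι-sum {zero}  f = refl
  ι-sum {suc n} f = trans (×-homo-+ 1# (f zero) _) (+-congˡ (ι-sum (f ∘ suc)))

  ⟨⟩-cong : (A : Matrix Carrier n) {B C : Matrix Carrier n} → (∀ i j → B i j ≈ C i j) → ⟨ A , B ⟩ ≈ ⟨ A , C ⟩
  ⟨⟩-cong A B≈C = ∑∑-cong λ i j → *-congˡ (B≈C i j)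

  ⟨⟩-+ : (A B C : Matrix Carrier n) → ⟨ A , (λ i j → B i j + C i j) ⟩ ≈ ⟨ A , B ⟩ + ⟨ A , C ⟩
  ⟨⟩-+ A B C = trans (∑∑-cong λ i j → distribˡ (A i j) (B i j) (C i j)) (∑∑-distrib-+ (λ i j → A i j * B i j) (λ i j → A i j * C i j))

  ⟨⟩-* : ∀ x (A B : Matrix Carrier n) → ⟨ A , (λ i j → x * B i j) ⟩ ≈ x * ⟨ A , B ⟩
  ⟨⟩-* x A B = trans (∑∑-cong λ i j → x∙yz≈y∙xz (A i j) x (B i j)) (sym (*-distribˡ-∑∑ x (λ i j → A i j * B i j)))
    where
    x∙yz≈y∙xz : ∀ x y z → x * (y * z) ≈ y * (x * z)
    x∙yz≈y∙xz x y z = trans (sym (*-assoc x y z)) (trans (*-congʳ (*-comm x y)) (*-assoc y x z))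

  ⟨⟦⟧,⟦⟧⟩ : (M N : Matrix Bool n) → ⟨ ⟦ M ⟧ , ⟦ N ⟧ ⟩ ≈ ι (commonArcs M N)
  ⟨⟦⟧,⟦⟧⟩ M N = sym (trans (ι-sum (λ i → count λ j → M i j ∧ N i j))
    (sum-cong-≋ λ i → trans (ι-sum (λ j → bit (M i j ∧ N i j))) (sum-cong-≋ λ j → entry (M i j) (N i j))))
    where
    entry : ∀ x y → ι (bit (x ∧ y)) ≈ (if x then 1# else 0#) * (if y then 1# else 0#)
    entry true  true  = trans (+-identityʳ 1#) (sym (*-identityʳ 1#))
    entry true  false = sym (zeroʳ 1#)
    entry false _     = sym (zeroˡ _)

  -- The objective values in terms of counts.

  module _ (ε : Carrier) where

    ⟨⟩-Qₜ : (M X : Matrix Bool n) {Q : Matrix Carrier n} →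
            (∀ i j → Q i j ≈ (1# + ε) * ⟦ X ⟧ i j) →
            ⟨ ⟦ M ⟧ , Q ⟩ ≈ (1# + ε) * ι (commonArcs M X)
    ⟨⟩-Qₜ M X Q≈ = trans (⟨⟩-cong ⟦ M ⟧ Q≈) (trans (⟨⟩-* _ ⟦ M ⟧ ⟦ X ⟧) (*-congˡ (⟨⟦⟧,⟦⟧⟩ M X)))

    ⟨⟩-Qₙₜ : .{{_ : NonZero n}} (M X : Matrix Bool n) {Q : Matrix Carrier n} →
             (∀ i j → Q i j ≈ ⟦ X ⟧ i j + ε * B̄ n i j) →
             ⟨ ⟦ M ⟧ , Q ⟩ ≈ ι (commonArcs M X) + ε * 1/ n * ι (commonArcs M full)
    ⟨⟩-Qₙₜ {n} M X {Q} Q≈ = begin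
      ⟨ ⟦ M ⟧ , Q ⟩
        -- The constant matrix is rewritten as a multiple of `⟦ full ⟧`, whose entries are 1.
        ≈⟨ ⟨⟩-cong ⟦ M ⟧ (λ i j → trans (Q≈ i j) (+-congˡ (sym (*-identityʳ _)))) ⟩
      ⟨ ⟦ M ⟧ , (λ i j → ⟦ X ⟧ i j + ε * 1/ n * ⟦ full ⟧ i j) ⟩
        ≈⟨ ⟨⟩-+ ⟦ M ⟧ ⟦ X ⟧ (λ i j → ε * 1/ n * ⟦ full ⟧ i j) ⟩
      ⟨ ⟦ M ⟧ , ⟦ X ⟧ ⟩ + ⟨ ⟦ M ⟧ , (λ i j → ε * 1/ n * ⟦ full ⟧ i j) ⟩
        ≈⟨ +-cong (⟨⟦⟧,⟦⟧⟩ M X) (trans (⟨⟩-* (ε * 1/ n) ⟦ M ⟧ ⟦ full ⟧) (*-congˡ (⟨⟦⟧,⟦⟧⟩ M full))) ⟩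
      ι (commonArcs M X) + ε * 1/ n * ι (commonArcs M full)
        ∎
      where open SetoidReasoning setoid

    -- With n = p + 1, the left side is the non-tour value when both counts are extremal, k = n and
    -- e = n (n - 1). It serves both the upper bound and the case of equality.
    nonTourBound : ∀ p → ι (suc p) + ε * 1/ (suc p) * ι (suc p ℕ.* p) ≈ ι (suc p) * (1# + ε) - ε
    nonTourBound p = begin
      ι (suc p) + ε * 1/ (suc p) * ι (suc p ℕ.* p)   ≈⟨ +-congˡ scaled ⟩
      ι (suc p) + ε * ι p                            ≈⟨ +-congˡ (+-identityʳ _) ⟨
      -- Inserting `ε - ε` completes `ε * ι p` to `ε * ι (suc p)`.
      ι (suc p) + (ε * ι p + 0#)                     ≈⟨ +-congˡ (+-congˡ (-‿inverseʳ ε)) ⟨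
      ι (suc p) + (ε * ι p + (ε - ε))                ≈⟨ +-congˡ (+-assoc _ _ _) ⟨
      ι (suc p) + (ε * ι p + ε - ε)                  ≈⟨ +-assoc _ _ _ ⟨
      ι (suc p) + (ε * ι p + ε) - ε                  ≈⟨ +-congʳ (+-cong (sym (*-identityʳ _)) product) ⟩
      ι (suc p) * 1# + ι (suc p) * ε - ε             ≈⟨ +-congʳ (distribˡ _ _ _) ⟨
      ι (suc p) * (1# + ε) - ε                       ∎
      where
      open SetoidReasoning setoid
      scaled : ε * 1/ (suc p) * ι (suc p ℕ.* p) ≈ ε * ι p
      scaled = begin
        ε * 1/ (suc p) * ι (suc p ℕ.* p)         ≈⟨ *-assoc _ _ _ ⟩
        ε * (1/ (suc p) * ι (suc p ℕ.* p))       ≈⟨ *-congˡ (*-congˡ (×1-homo-* (suc p) p)) ⟩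
        ε * (1/ (suc p) * (ι (suc p) * ι p))     ≈⟨ *-congˡ (*-assoc _ _ _) ⟨
        ε * (1/ (suc p) * ι (suc p) * ι p)       ≈⟨ *-congˡ (*-congʳ (trans (*-comm _ _) (ι*1/ (suc p)))) ⟩
        ε * (1# * ι p)                           ≈⟨ *-congˡ (*-identityˡ _) ⟩
        ε * ι p                                  ∎
      product : ε * ι p + ε ≈ ι (suc p) * ε
      product = begin
        ε * ι p + ε          ≈⟨ +-comm _ _ ⟩
        ε + ε * ι p          ≈⟨ +-cong (sym (*-identityˡ ε)) (*-comm _ _) ⟩
        1# * ε + ι p * ε     ≈⟨ distribʳ ε 1# (ι p) ⟨
        ι (suc p) * ε        ∎

  -- The two maxima.

  module _ (ε : Carrier) (0<ε : 0# < ε) (G : SimpleDigraph (suc n)) where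
    open SimpleDigraph G

    tourMaximum : Hamiltonian G → IsMaximum (λ Q → ⟨ ⟦ adjacency ⟧ , Q ⟩) (Qₜ ε) (ι (suc n) * (1# + ε))
    tourMaximum h =
      ((λ i j → (1# + ε) * ⟦ tour G h ⟧ i j) , (tour G h , tour∈Pₜ G h , λ i j → refl) ,
        trans (⟨⟩-Qₜ ε adjacency (tour G h) λ i j → refl)
          (trans (*-congˡ (×-congˡ (commonArcs-tour G h))) (*-comm _ _))) ,
      λ Q (X , (X∈P , _) , Q≈) → ≲⇒≤
        (≲-trans (inj₂ (⟨⟩-Qₜ ε adjacency X Q≈))
        (≲-trans (*-monoʳ-≲ 0<1+ε (ι-mono (commonArcs-P adjacency X∈P)))
                 (inj₂ (*-comm _ _))))
      where
      0<1+ε : 0# < 1# + ε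
      0<1+ε = <-trans 0<ε (<-respˡ-≈ (+-identityˡ ε) (+-monoˡ-< ε 0<1))

    -- The term in e is the same for all non-tours, so maximising k suffices; the bound then
    -- estimates k and e separately.
    nonTourMaximum : ∃[ m ] IsMaximum (λ Q → ⟨ ⟦ adjacency ⟧ , Q ⟩) (Qₙₜ ε) m × m ≤ ι (suc n) * (1# + ε) - ε
    nonTourMaximum = let (X , X∈Pₙₜ , maximal) = maximalNonTour adjacency in
      value (commonArcs adjacency X) ,
      (((λ i j → ⟦ X ⟧ i j + ε * B̄ (suc n) i j) , (X , X∈Pₙₜ , λ i j → refl) , ⟨⟩-Qₙₜ ε adjacency X (λ i j → refl)) ,
       λ Q (Y , Y∈Pₙₜ , Q≈) → ≲⇒≤
         (≲-trans (inj₂ (⟨⟩-Qₙₜ ε adjacency Y Q≈)) (+-monoˡ-≲ _ (ι-mono (maximal Y∈Pₙₜ))))) ,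
      ≲⇒≤
        (≲-trans (+-monoˡ-≲ _ (ι-mono (commonArcs-P adjacency (proj₁ X∈Pₙₜ))))
        (≲-trans (+-monoʳ-≲ _ (*-monoʳ-≲ (*-pos 0<ε (0<1/ (suc n))) (ι-mono (commonArcs-full {M = adjacency} zeroDiagonal))))
                 (inj₂ (nonTourBound ε n))))
      where
      value : ℕ → Carrier
      value k = ι k + ε * 1/ (suc n) * ι (commonArcs adjacency full)

  nonTourBoundAttained : ∀ ε → ∃[ Q ] Q ∈ Qₙₜ ε × ⟨ ⟦ SimpleDigraph.adjacency K₄ ⟧ , Q ⟩ ≈ ι 4 * (1# + ε) - ε
  nonTourBoundAttained ε =
    (λ i j → ⟦ twoCycles ⟧ i j + ε * B̄ 4 i j) , (twoCycles , twoCycles∈Pₙₜ , λ i j → refl) ,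
    -- Both counts compute: 4 common arcs with `twoCycles` and 12 = 4 · 3 arcs in `K₄`, which is
    -- `nonTourBound` at 3.
    trans (⟨⟩-Qₙₜ ε (SimpleDigraph.adjacency K₄) twoCycles λ i j → refl) (nonTourBound ε 3)

-- "May be attained" is rendered by the last component: some Hamiltonian digraph has a non-tour
-- point where the bound is an equality.
theorem2p1 : ∀ {c ℓ₁ ℓ₂ ℓ₃} (F : OrderedField c ℓ₁ ℓ₂ ℓ₃) →
    let open OrderedField F
        open Over F
        open SimpleDigraph
    in
    (ε : Carrier) → 0# < ε →
    ((n : ℕ) {{_ : NonZero n}} (G : SimpleDigraph n) → Hamiltonian G →
       IsMaximum (λ Q → ⟨ ⟦ adjacency G ⟧ , Q ⟩) (Qₜ ε) (ι n * (1# + ε))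
       ×
       (∃[ m ] IsMaximum (λ Q → ⟨ ⟦ adjacency G ⟧ , Q ⟩) (Qₙₜ ε) m
             × m ≤ ι n * (1# + ε) - ε))
    ×
    (∃[ n ] Σ[ nz ∈ NonZero n ] Σ[ G ∈ SimpleDigraph n ]
       Hamiltonian G
       × (∃[ Q ] Q ∈ Qₙₜ {{nz}} ε
               × ⟨ ⟦ adjacency G ⟧ , Q ⟩ ≈ ι n * (1# + ε) - ε))
theorem2p1 F ε 0<ε =
  (λ { (suc n) G hamiltonian → tourMaximum F ε 0<ε G hamiltonian , nonTourMaximum F ε 0<ε G }) ,
  4 , _ , K₄ , K₄-hamiltonian , nonTourBoundAttained F ε
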